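{- For any oriented graph $G$, $\omega_{ro}(G) \leq \chi^*_o(G) \leq \chi_o(G)$.
   Context: An oriented graph is a finite directed graph with no directed cycle of length 1 or 2. A homomorphism of an oriented graph $G$ to an oriented graph $H$ is a map $f:V(G)\to V(H)$ such that $f(x)f(y)$ is an arc of $H$ whenever $xy$ is an arc of $G$. An oriented relative clique of $G$ is a set $R\subseteq V(G)$ such that $f(x)\neq f(y)$ for every homomorphism $f$ of $G$ to any oriented graph and all distinct $x,y\in R$; $\omega_{ro}(G)$ is the maximum size of an oriented relative clique. For a set $S$ of $k$ colors, a $b$-fold oriented $k$-coloring of $G$ is a map $f$ from $V(G)$ to the $b$-element subsets of $S$ such that (i) $f(x)\cap f(y)=\emptyset$ for every arc $xy$, and (ii) for all arcs $xy, zw$, $f(x)\cap f(w)\neq\emptyset$ implies $f(y)\cap f(z)=\emptyset$. $\chi^b_o(G)$ is the minimum $k$ admitting such a coloring; $\chi_o(G)=\chi^1_o(G)$ is the oriented chromatic number, and $\chi^*_o(G)=\lim_{b\to\infty}\chi^b_o(G)/b=\inf_{b\ge1}\chi^b_o(G)/b$ is the fractional oriented chromatic number. -}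

module Defs where

open import Data.Bool.Base using (true; false)
open import Data.Fin.Base using (Fin; zero; suc)
open import Data.Fin.Properties using (all?; any?; _≟_)
open import Data.Fin.Subset
  using (Subset; _∈_; _∩_; ∣_∣; ⊤; ⊥; Empty; Nonempty)
open import Data.Fin.Subset.Properties
  using (_∈?_; nonempty?; anySubset?; ∣p∣≤n; ∣⊥∣≡0; ∣⊤∣≡n; ∉⊥; x∈p∩q⁻)
open import Data.Integer.Base using (+_)
open import Data.Nat.Base as ℕ using (ℕ; zero; suc; z≤n; s≤s)
import Data.Nat.Properties as ℕ
open import Data.Product.Base using (Σ; ∃; ∃₂; _×_; _,_; proj₁; proj₂)
open import Data.Rational.Base as ℚ using (ℚ; 0ℚ; 1ℚ; _/_)
import Data.Rational.Properties as ℚ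
open import Data.Vec.Base using ([]; _∷_; _++_; here; there)
open import Function.Base using (_∘_)
open import Level using (Level; 0ℓ)
open import Relation.Binary.Core using (Rel; _Preserves_⟶_)
import Relation.Binary.Definitions as B
open import Relation.Binary.PropositionalEquality
  using (_≡_; _≢_; _≗_; refl; sym; trans; cong; cong₂; subst; subst₂)
open import Relation.Nullary
  using (¬_; Dec; yes; no; ¬?; _×-dec_; _→-dec_; map′; contradiction)
open import Relation.Unary using (Pred; Decidable)

private
  variable
    ℓ : Level
    n k : ℕ

Maximum : Pred ℕ ℓ → Set ℓ
Maximum P = Σ ℕ λ m → P m × (∀ {m′} → P m′ → m′ ℕ.≤ m)

Minimum : Pred ℕ ℓ → Set ℓ
Minimum P = Σ ℕ λ m → P m × (∀ {m′} → P m′ → m ℕ.≤ m′)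

maximum : {P : Pred ℕ ℓ} → Decidable P → P 0 →
          ∀ b → (∀ {m} → P m → m ℕ.≤ b) → Maximum P
maximum P? p₀ zero    bd = 0 , p₀ , bd
maximum {P = P} P? p₀ (suc b) bd with P? (suc b)
... | yes p = suc b , p , bd
... | no ¬p = maximum P? p₀ b λ {m} pm →
  ℕ.≤-pred (ℕ.≤∧≢⇒< (bd pm) λ eq → ¬p (subst P eq pm))

minimum : {P : Pred ℕ ℓ} → Decidable P → ∀ b → P b → Minimum P
minimum         P? zero    p = 0 , p , λ _ → z≤n
minimum {P = P} P? (suc b) p with P? 0
... | yes p₀ = 0 , p₀ , λ _ → z≤n
... | no ¬p₀ with minimum (P? ∘ suc) b p
...   | m , pm , least = suc m , pm , bound
  where
  bound : ∀ {m′} → P m′ → suc m ℕ.≤ m′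
  bound {zero}   p₀ = contradiction p₀ ¬p₀
  bound {suc m′} p′ = s≤s (least p′)

-- A real number x is given by the set { q ∈ ℚ ∣ x < q }.  The fields say
-- that this set is a nonempty, open, upward closed set of rationals that
-- is bounded below.  Classically these are exactly the Dedekind reals;
-- constructively, one-sided cuts are what admits infima of arbitrary
-- inhabited families of rationals that are bounded below.
record ℝ : Set₁ where
  field
    Above     : Pred ℚ 0ℓ
    inhabited : ∃ Above
    upward    : ∀ {p q} → p ℚ.< q → Above p → Above q
    open′     : ∀ {q} → Above q → ∃ λ p → p ℚ.< q × Above p
    bounded   : ∃ λ p → ∀ {q} → Above q → p ℚ.< q

open ℝ public using (Above)

infix 4 _≤ᴿ_

_≤ᴿ_ : Rel ℝ 0ℓ
x ≤ᴿ y = ∀ {q} → Above y q → Above x q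

q<q+1 : ∀ q → q ℚ.< q ℚ.+ 1ℚ
q<q+1 q = subst (ℚ._< q ℚ.+ 1ℚ) (ℚ.+-identityʳ q)
                (ℚ.+-monoʳ-< q {0ℚ} {1ℚ} (ℚ.positive⁻¹ 1ℚ))

fromℚ : ℚ → ℝ
fromℚ r = record
  { Above     = r ℚ.<_
  ; inhabited = r ℚ.+ 1ℚ , q<q+1 r
  ; upward    = λ p<q r<p → ℚ.<-trans r<p p<q
  ; open′     = λ r<q → let p , r<p , p<q = ℚ.<-dense r<q in p , p<q , r<p
  ; bounded   = r , λ r<q → r<q
  }

fromℕ : ℕ → ℝ
fromℕ m = fromℚ (+ m / 1)

infimum : {I : Set} (i₀ : I) (s : I → ℚ) → (∃ λ p → ∀ i → p ℚ.≤ s i) → ℝ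
infimum i₀ s (p , p≤s) = record
  { Above     = λ q → ∃ λ i → s i ℚ.< q
  ; inhabited = s i₀ ℚ.+ 1ℚ , i₀ , q<q+1 (s i₀)
  ; upward    = λ p<q (i , si<p) → i , ℚ.<-trans si<p p<q
  ; open′     = λ (i , si<q) →
                  let r , si<r , r<q = ℚ.<-dense si<q in r , r<q , i , si<r
  ; bounded   = p , λ (i , si<q) → ℚ.≤-<-trans (p≤s i) si<q
  }

module _ {I : Set} (i₀ : I) (s : I → ℚ) (lb : ∃ λ p → ∀ i → p ℚ.≤ s i) where

  infimum-lowerBound : ∀ i → infimum i₀ s lb ≤ᴿ fromℚ (s i)
  infimum-lowerBound i si<q = i , si<q

  infimum-greatest : ∀ x → (∀ i → x ≤ᴿ fromℚ (s i)) → x ≤ᴿ infimum i₀ s lb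
  infimum-greatest x x≤s (i , si<q) = x≤s i si<q

record OrientedGraph : Set₁ where
  field
    order    : ℕ
    Arc      : Rel (Fin order) 0ℓ
    arc?     : B.Decidable Arc
    no1Cycle : ∀ {x} → ¬ Arc x x
    no2Cycle : ∀ {x y} → Arc x y → ¬ Arc y x

  Vertex : Set
  Vertex = Fin order

open OrientedGraph public using (order; Vertex; Arc)

IsHomomorphism : (G H : OrientedGraph) → (Vertex G → Vertex H) → Set
IsHomomorphism G H f = f Preserves Arc G ⟶ Arc H

Separated : (G : OrientedGraph) → Rel (Vertex G) _
Separated G x y = ∀ (H : OrientedGraph) (f : Vertex G → Vertex H) →
                  IsHomomorphism G H f → f x ≢ f y

IsRelativeClique : (G : OrientedGraph) → Subset (order G) → Set₁
IsRelativeClique G R = ∀ {x y} → x ∈ R → y ∈ R → x ≢ y → Separated G x y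

-- Some homomorphism identifies x and y iff the digraph obtained from G by
-- merging y into x is an oriented graph.
module Merge (G : OrientedGraph) (x y : Vertex G) where
  open OrientedGraph G using (arc?)

  merge : Vertex G → Vertex G
  merge u with u ≟ y
  ... | yes _ = x
  ... | no  _ = u

  merge-identifies : merge x ≡ merge y
  merge-identifies with x ≟ y | y ≟ y
  ... | yes _ | yes _  = refl
  ... | no  _ | yes _  = refl
  ... | _     | no y≢y = contradiction refl y≢y

  Arcᵐ : Rel (Vertex G) 0ℓ
  Arcᵐ u v = ∃₂ λ a b → merge a ≡ u × merge b ≡ v × Arc G a b

  arcᵐ? : B.Decidable Arcᵐ
  arcᵐ? u v = any? λ a → any? λ b →
    (merge a ≟ u) ×-dec (merge b ≟ v) ×-dec arc? a b

  asymᵐ? : Dec (∀ u v → Arcᵐ u v → ¬ Arcᵐ v u)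
  asymᵐ? = all? λ u → all? λ v → arcᵐ? u v →-dec ¬? (arcᵐ? v u)

  merged : (∀ u v → Arcᵐ u v → ¬ Arcᵐ v u) → OrientedGraph
  merged asym = record
    { order    = order G
    ; Arc      = Arcᵐ
    ; arc?     = arcᵐ?
    ; no1Cycle = λ a → asym _ _ a a
    ; no2Cycle = asym _ _
    }

  module _ (H : OrientedGraph) (f : Vertex G → Vertex H)
           (hom : IsHomomorphism G H f) (fx≡fy : f x ≡ f y) where

    factor : ∀ u → f (merge u) ≡ f u
    factor u with u ≟ y
    ... | yes u≡y = trans fx≡fy (cong f (sym u≡y))
    ... | no  _   = refl

    preserves : ∀ {u v} → Arcᵐ u v → Arc H (f u) (f v)
    preserves (a , b , refl , refl , ab) =
      subst₂ (Arc H) (sym (factor a)) (sym (factor b)) (hom ab)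

  separated? : Dec (Separated G x y)
  separated? with asymᵐ?
  ... | yes asym = no λ sep →
    sep (merged asym) merge (λ ab → _ , _ , refl , refl , ab) merge-identifies
  ... | no ¬asym = yes λ H f hom fx≡fy → ¬asym λ u v uv vu →
    OrientedGraph.no2Cycle H
      (preserves H f hom fx≡fy uv) (preserves H f hom fx≡fy vu)

isRelativeClique? : ∀ G → Decidable (IsRelativeClique G)
isRelativeClique? G R =
  map′ (λ c x∈R y∈R → c _ _ x∈R y∈R) (λ c _ _ → c)
    (all? λ x → all? λ y →
      (x ∈? R) →-dec (y ∈? R) →-dec ¬? (x ≟ y) →-dec Merge.separated? G x y)

HasRelativeClique : OrientedGraph → Pred ℕ _
HasRelativeClique G m = ∃ λ R → IsRelativeClique G R × ∣ R ∣ ≡ m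

relativeCliqueNumber : ∀ G → Maximum (HasRelativeClique G)
relativeCliqueNumber G = maximum
  (λ m → anySubset? λ R → isRelativeClique? G R ×-dec (∣ R ∣ ℕ.≟ m))
  (⊥ , (λ x∈⊥ → contradiction x∈⊥ ∉⊥) , ∣⊥∣≡0 (order G))
  (order G)
  λ { (R , _ , refl) → ∣p∣≤n R }

ωᵣₒ : OrientedGraph → ℕ
ωᵣₒ G = proj₁ (relativeCliqueNumber G)

record IsOrientedColouring (G : OrientedGraph) (b k : ℕ)
                           (f : Vertex G → Subset k) : Set where
  field
    size       : ∀ x → ∣ f x ∣ ≡ b
    proper     : ∀ {x y} → Arc G x y → Empty (f x ∩ f y)
    consistent : ∀ {x y z w} → Arc G x y → Arc G z w →
                 Nonempty (f x ∩ f w) → Empty (f y ∩ f z)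

OrientedColourable : OrientedGraph → (b k : ℕ) → Set
OrientedColourable G b k = ∃ (IsOrientedColouring G b k)

private

  anyFunction? : ∀ m {P : Pred (Fin m → Subset k) ℓ} →
                 (∀ {f g} → f ≗ g → P f → P g) → Decidable P → Dec (∃ P)
  anyFunction? {k = k} zero {P} resp P? =
    map′ (none ,_) (λ (_ , p) → resp (λ ()) p) (P? none)
    where
    none : Fin 0 → Subset k
    none ()
  anyFunction? {k = k} (suc m) {P} resp P? =
    map′ (λ (s , f , p) → cons s f , p)
         (λ (f , p) → f zero , f ∘ suc , resp (η f) p)
         (anySubset? λ s →
           anyFunction? m (λ f≗g → resp (cons-cong f≗g)) (P? ∘ cons s))
    where
    cons : Subset k → (Fin m → Subset k) → Fin (suc m) → Subset k
    cons s f zero    = s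
    cons s f (suc i) = f i

    cons-cong : ∀ {s f g} → f ≗ g → cons s f ≗ cons s g
    cons-cong f≗g zero    = refl
    cons-cong f≗g (suc i) = f≗g i

    η : ∀ f → f ≗ cons (f zero) (f ∘ suc)
    η f zero    = refl
    η f (suc i) = refl

  isOrientedColouring? : ∀ G b k → Decidable (IsOrientedColouring G b k)
  isOrientedColouring? G b k f = map′
    (λ (s , p , c) → record
      { size = s ; proper = p _ _ ; consistent = c _ _ _ _ })
    (λ c → let open IsOrientedColouring c in
      size , (λ _ _ → proper) , (λ _ _ _ _ → consistent))
    ( (all? λ x → ∣ f x ∣ ℕ.≟ b)
    ×-dec (all? λ x → all? λ y → arc? x y →-dec empty? (f x ∩ f y))
    ×-dec (all? λ x → all? λ y → all? λ z → all? λ w →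
             arc? x y →-dec arc? z w →-dec
             nonempty? (f x ∩ f w) →-dec empty? (f y ∩ f z)))
    where
    open OrientedGraph G using (arc?)

    empty? : Decidable (Empty {k})
    empty? p = ¬? (nonempty? p)

  resp-≗ : ∀ G b k {f g} → f ≗ g →
           IsOrientedColouring G b k f → IsOrientedColouring G b k g
  resp-≗ G b k {f} {g} f≗g c = record
    { size       = λ x → trans (cong ∣_∣ (sym (f≗g x))) (size x)
    ; proper     = λ {x} {y} xy → subst Empty (eq x y) (proper xy)
    ; consistent = λ {x} {y} {z} {w} xy zw ne →
        subst Empty (eq y z)
          (consistent xy zw (subst Nonempty (sym (eq x w)) ne))
    }
    where
    open IsOrientedColouring c

    eq : ∀ x y → f x ∩ f y ≡ g x ∩ g y
    eq x y = cong₂ _∩_ (f≗g x) (f≗g y)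

orientedColourable? : ∀ G b → Decidable (OrientedColourable G b)
orientedColourable? G b k =
  anyFunction? (order G) (resp-≗ G b k) (isOrientedColouring? G b k)

-- Giving the vertices pairwise disjoint blocks of b colours is always an
-- oriented colouring, so the minimum defining χᵇₒ exists.
private

  block : ∀ n b → Fin n → Subset (n ℕ.* b)
  block (suc n) b zero    = ⊤ {b} ++ ⊥ {n ℕ.* b}
  block (suc n) b (suc x) = ⊥ {b} ++ block n b x

  ∣++∣ : ∀ {m n} (p : Subset m) (q : Subset n) → ∣ p ++ q ∣ ≡ ∣ p ∣ ℕ.+ ∣ q ∣
  ∣++∣ []          q = refl
  ∣++∣ (true  ∷ p) q = cong suc (∣++∣ p q)
  ∣++∣ (false ∷ p) q = ∣++∣ p q

  ∣block∣ : ∀ n b x → ∣ block n b x ∣ ≡ b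
  ∣block∣ (suc n) b zero = trans (∣++∣ (⊤ {b}) (⊥ {n ℕ.* b}))
    (trans (cong₂ ℕ._+_ (∣⊤∣≡n b) (∣⊥∣≡0 (n ℕ.* b))) (ℕ.+-identityʳ b))
  ∣block∣ (suc n) b (suc x) = trans (∣++∣ (⊥ {b}) (block n b x))
    (cong₂ ℕ._+_ (∣⊥∣≡0 b) (∣block∣ n b x))

  disjoint-++ : ∀ {m n} (p p′ : Subset m) {q q′ : Subset n} →
                Empty (p ∩ p′) → Empty (q ∩ q′) → Empty ((p ++ q) ∩ (p′ ++ q′))
  disjoint-++ []      []        _ e  ne = e ne
  disjoint-++ (true  ∷ p) (true  ∷ p′) d e _ = d (zero , here)
  disjoint-++ (true  ∷ p) (false ∷ p′) d e (suc i , there i∈) =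
    disjoint-++ p p′ (λ (j , j∈) → d (suc j , there j∈)) e (i , i∈)
  disjoint-++ (false ∷ p) (_     ∷ p′) d e (suc i , there i∈) =
    disjoint-++ p p′ (λ (j , j∈) → d (suc j , there j∈)) e (i , i∈)

  ⊥-∩ : ∀ {m} (p : Subset m) → Empty (⊥ ∩ p)
  ⊥-∩ p (i , i∈) = ∉⊥ (proj₁ (x∈p∩q⁻ ⊥ p i∈))

  ∩-⊥ : ∀ {m} (p : Subset m) → Empty (p ∩ ⊥)
  ∩-⊥ p (i , i∈) = ∉⊥ (proj₂ (x∈p∩q⁻ p ⊥ i∈))

  disjoint : ∀ n b {x y} → x ≢ y → Empty (block n b x ∩ block n b y)
  disjoint (suc n) b {zero}  {zero}  x≢y = contradiction refl x≢y
  disjoint (suc n) b {zero}  {suc y} x≢y =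
    disjoint-++ (⊤ {b}) ⊥ (∩-⊥ ⊤) (⊥-∩ (block n b y))
  disjoint (suc n) b {suc x} {zero}  x≢y =
    disjoint-++ (⊥ {b}) ⊤ (⊥-∩ ⊤) (∩-⊥ (block n b x))
  disjoint (suc n) b {suc x} {suc y} x≢y =
    disjoint-++ (⊥ {b}) ⊥ (⊥-∩ ⊥) (disjoint n b (x≢y ∘ cong suc))

  blockColouring : ∀ G b → IsOrientedColouring G b _ (block (order G) b)
  blockColouring G b = record
    { size       = ∣block∣ (order G) b
    ; proper     = λ xy → disjoint (order G) b λ { refl → no1Cycle xy }
    ; consistent = consistent
    }
    where
    open OrientedGraph G using (no1Cycle; no2Cycle)
    f = block (order G) b

    consistent : ∀ {x y z w} → Arc G x y → Arc G z w →
                 Nonempty (f x ∩ f w) → Empty (f y ∩ f z)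
    consistent {x} {y} {z} {w} xy zw ne with x ≟ w | y ≟ z
    ... | no x≢w   | _        = contradiction ne (disjoint (order G) b x≢w)
    ... | yes refl | yes refl = contradiction zw (no2Cycle xy)
    ... | yes refl | no y≢z   = disjoint (order G) b y≢z

foldChromaticNumber : ∀ G b → Minimum (OrientedColourable G b)
foldChromaticNumber G b = minimum (orientedColourable? G b) (order G ℕ.* b)
  (block (order G) b , blockColouring G b)

χᵇₒ : OrientedGraph → ℕ → ℕ
χᵇₒ G b = proj₁ (foldChromaticNumber G b)

χₒ : OrientedGraph → ℕ
χₒ G = χᵇₒ G 1

-- The index b stands for the fold number suc b, so that it ranges over all
-- positive fold numbers.  The infimum of these ratios is also their limit:
-- χᵇₒ G is monotone, and χᵇₒ G (a * b) ≤ a * χᵇₒ G b by replacing each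
-- colour with a copies.
foldRatio : OrientedGraph → ℕ → ℚ
foldRatio G b = + χᵇₒ G (suc b) / suc b

0≤foldRatio : ∀ G b → 0ℚ ℚ.≤ foldRatio G b
0≤foldRatio G b = ℚ.nonNegative⁻¹ (foldRatio G b)
  {{ℚ.normalize-nonNeg (χᵇₒ G (suc b)) (suc b)}}

χ*ₒ : OrientedGraph → ℝ
χ*ₒ G = infimum 0 (foldRatio G) (0ℚ , 0≤foldRatio G)

{-# OPTIONS --safe #-}

-- If two vertices x and y share a colour c in a b-fold oriented colouring
-- (b ≥ 1), give every vertex one colour of its colour set, taking c whenever
-- possible.  This is a homomorphism to an oriented graph on the colours that
-- identifies x and y.  Hence the vertices of a relative clique R have pairwise
-- disjoint colour sets, and b ∣R∣ ≤ k.

module Submission where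

open import Defs
open import Data.Fin.Base using (Fin; zero; suc)
open import Data.Fin.Properties using (any?; _≟_; suc-injective)
open import Data.Fin.Subset
  using (Subset; inside; outside; _∈_; _∩_; _∪_; ∣_∣; ⊥; Empty; Nonempty)
open import Data.Fin.Subset.Properties
  using (_∈?_; nonempty?; Empty-unique; drop-∷-Empty; ∣p∣≤n; ∣⊥∣≡0; ∉⊥; x∈p∩q⁺;
         x∈p∩q⁻; x∈p∪q⁻)
open import Data.Integer.Base as ℤ using (+_; +≤+)
import Data.Integer.Properties as ℤ
open import Data.Nat.Base using (ℕ; suc; _+_; _*_; _≤_; z≤n; s≤s)
open import Data.Nat.Properties
  using (+-identityʳ; +-monoˡ-≤; +-assoc; +-suc;
         module ≤-Reasoning)
open import Data.Product.Base using (∃₂; _×_; _,_; proj₁; proj₂)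
open import Data.Rational.Base as ℚ using (_/_; toℚᵘ)
import Data.Rational.Properties as ℚ
open import Data.Rational.Unnormalised.Base using (mkℚᵘ; *≤*)
import Data.Rational.Unnormalised.Properties as ℚᵘ
open import Data.Sum.Base using (inj₁; inj₂)
open import Data.Vec.Base using ([]; _∷_; here; there)
open import Function.Base using (_∘_)
open import Relation.Binary.PropositionalEquality
  using (_≡_; _≢_; refl; sym; trans; cong; subst; subst₂)
open import Relation.Nullary using (yes; no; contradiction; _×-dec_)

private
  variable
    b k n : ℕ

∣p∣+∣q∣≤∣p∪q∣ : (p q : Subset n) → Empty (p ∩ q) → ∣ p ∣ + ∣ q ∣ ≤ ∣ p ∪ q ∣
∣p∣+∣q∣≤∣p∪q∣ []            []            _ = z≤n
∣p∣+∣q∣≤∣p∪q∣ (inside  ∷ p) (inside  ∷ q) e = contradiction (zero , here) e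
∣p∣+∣q∣≤∣p∪q∣ (inside  ∷ p) (outside ∷ q) e =
  s≤s (∣p∣+∣q∣≤∣p∪q∣ p q (drop-∷-Empty e))
∣p∣+∣q∣≤∣p∪q∣ (outside ∷ p) (inside  ∷ q) e =
  subst (_≤ suc ∣ p ∪ q ∣) (sym (+-suc ∣ p ∣ ∣ q ∣))
    (s≤s (∣p∣+∣q∣≤∣p∪q∣ p q (drop-∷-Empty e)))
∣p∣+∣q∣≤∣p∪q∣ (outside ∷ p) (outside ∷ q) e =
  ∣p∣+∣q∣≤∣p∪q∣ p q (drop-∷-Empty e)

∣p∣≡suc⇒Nonempty : (p : Subset n) → ∣ p ∣ ≡ suc b → Nonempty p
∣p∣≡suc⇒Nonempty {n = n} p eq with nonempty? p
... | yes ne = ne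
... | no  e  = contradiction
  (trans (sym eq) (trans (cong ∣_∣ (Empty-unique e)) (∣⊥∣≡0 n))) λ ()

-- `U` accumulates the colours already used. Induction on `R` moves the `b` colours of each member
-- into `U`, and at the end `U` still lies within the `k` colours.
packing : (U : Subset k) (R : Subset n) (f : Fin n → Subset k) →
          (∀ x → ∣ f x ∣ ≡ b) →
          (∀ {x} → x ∈ R → Empty (U ∩ f x)) →
          (∀ {x y} → x ∈ R → y ∈ R → x ≢ y → Empty (f x ∩ f y)) →
          ∣ U ∣ + ∣ R ∣ * b ≤ k
packing {k = k} U [] f size _ _ =
  subst (_≤ k) (sym (+-identityʳ ∣ U ∣)) (∣p∣≤n U)
packing U (outside ∷ R) f size avoid disjoint =
  packing U R (f ∘ suc) (size ∘ suc) (avoid ∘ there)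
    λ x∈R y∈R x≢y → disjoint (there x∈R) (there y∈R) (x≢y ∘ suc-injective)
packing {k = k} {b = b} U (inside ∷ R) f size avoid disjoint = begin
  ∣ U ∣ + (b + ∣ R ∣ * b)          ≡⟨ +-assoc ∣ U ∣ b _ ⟨
  ∣ U ∣ + b + ∣ R ∣ * b            ≡⟨ cong (λ m → ∣ U ∣ + m + ∣ R ∣ * b) (size zero) ⟨
  ∣ U ∣ + ∣ f zero ∣ + ∣ R ∣ * b   ≤⟨ +-monoˡ-≤ _ (∣p∣+∣q∣≤∣p∪q∣ U (f zero) (avoid here)) ⟩
  ∣ U ∪ f zero ∣ + ∣ R ∣ * b       ≤⟨ packing (U ∪ f zero) R (f ∘ suc) (size ∘ suc) avoid′
                                       (λ x∈R y∈R x≢y → disjoint (there x∈R) (there y∈R)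
                                                          (x≢y ∘ suc-injective)) ⟩
  k                                ∎
  where
  open ≤-Reasoning

  avoid′ : ∀ {x} → x ∈ R → Empty ((U ∪ f zero) ∩ f (suc x))
  avoid′ {x} x∈R (c , c∈) with x∈p∩q⁻ (U ∪ f zero) (f (suc x)) c∈
  ... | c∈∪ , c∈fx with x∈p∪q⁻ U (f zero) c∈∪
  ...   | inj₁ c∈U  = avoid (there x∈R) (c , x∈p∩q⁺ (c∈U , c∈fx))
  -- A colour just added to `U` came from vertex `zero`, a member of the clique different from
  -- `suc x`.
  ...   | inj₂ c∈f0 = disjoint here (there x∈R) (λ ()) (c , x∈p∩q⁺ (c∈f0 , c∈fx))

module _ {G : OrientedGraph} {f : Vertex G → Subset k}
         (colouring : IsOrientedColouring G b k f) where
  open OrientedGraph G using (arc?)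
  open IsOrientedColouring colouring

  module Selection (g : Vertex G → Fin k) (g∈f : ∀ v → g v ∈ f v) where

    -- The common chosen colour is the witness; this turns equalities of colours into the
    -- intersections that `proper` and `consistent` speak of.
    shared : ∀ {u v} → g u ≡ g v → Nonempty (f u ∩ f v)
    shared {u} {v} eq = g u , x∈p∩q⁺ (g∈f u , subst (_∈ f v) (sym eq) (g∈f v))

    -- The image of `G` under `g`, with all `k` colours kept as vertices.
    colourGraph : OrientedGraph
    colourGraph = record
      { order    = k
      ; Arc      = λ i j → ∃₂ λ u v → g u ≡ i × g v ≡ j × Arc G u v
      ; arc?     = λ i j → any? λ u → any? λ v →
                     (g u ≟ i) ×-dec (g v ≟ j) ×-dec arc? u v
      ; no1Cycle = λ (u , v , gu , gv , uv) →
                     proper uv (shared (trans gu (sym gv)))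
      -- For opposite arcs, `x` and `w` have one chosen colour and `y` and `z` the other, so both
      -- intersections in `consistent` are inhabited.
      ; no2Cycle = λ (x , y , gx , gy , xy) (z , w , gz , gw , zw) →
                     consistent xy zw (shared (trans gx (sym gw)))
                                      (shared (trans gy (sym gz)))
      }

    selection-hom : IsHomomorphism G colourGraph g
    selection-hom uv = _ , _ , refl , refl , uv

module _ {G : OrientedGraph} {f : Vertex G → Subset k}
         (colouring : IsOrientedColouring G (suc b) k f) where
  open IsOrientedColouring colouring

  private
    prefer : Fin k → Vertex G → Fin k
    prefer c v with c ∈? f v
    ... | yes _ = c
    -- The fallback colour exists because the fold number `suc b` is positive.
    ... | no  _ = proj₁ (∣p∣≡suc⇒Nonempty (f v) (size v))

    prefer∈f : ∀ c v → prefer c v ∈ f v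
    prefer∈f c v with c ∈? f v
    ... | yes c∈fv = c∈fv
    ... | no  _    = proj₂ (∣p∣≡suc⇒Nonempty (f v) (size v))

    prefer≡ : ∀ {c v} → c ∈ f v → prefer c v ≡ c
    prefer≡ {c} {v} c∈fv with c ∈? f v
    ... | yes _    = refl
    ... | no  c∉fv = contradiction c∈fv c∉fv

  separated⇒disjoint : ∀ {x y} → Separated G x y → Empty (f x ∩ f y)
  separated⇒disjoint {x} {y} sep (c , c∈) =
    let c∈fx , c∈fy = x∈p∩q⁻ (f x) (f y) c∈ in
    sep colourGraph (prefer c) selection-hom
      (trans (prefer≡ c∈fx) (sym (prefer≡ c∈fy)))
    where open Selection colouring (prefer c) (prefer∈f c)

  ∣clique∣*b≤k : ∀ {R} → IsRelativeClique G R → ∣ R ∣ * suc b ≤ k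
  ∣clique∣*b≤k {R} clique =
    subst (λ m → m + ∣ R ∣ * suc b ≤ k) (∣⊥∣≡0 k)
      (packing ⊥ R f size
        (λ {x} _ (_ , c∈) → ∉⊥ (proj₁ (x∈p∩q⁻ ⊥ (f x) c∈)))
        λ x∈R y∈R x≢y → separated⇒disjoint (clique x∈R y∈R x≢y))

-- Both extrema are attained, so the bound applies to a largest clique and a colouring with the
-- fewest colours.
ωᵣₒ*b≤χᵇₒ : ∀ G b → ωᵣₒ G * suc b ≤ χᵇₒ G (suc b)
ωᵣₒ*b≤χᵇₒ G b with relativeCliqueNumber G | foldChromaticNumber G (suc b)
... | _ , (R , clique , refl) , _ | _ , (f , colouring) , _ =
  ∣clique∣*b≤k colouring clique

m*d≤n⇒m/1≤n/d : ∀ m n d → m * suc d ≤ n → + m / 1 ℚ.≤ + n / suc d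
m*d≤n⇒m/1≤n/d m n d m*d≤n = ℚ.toℚᵘ-cancel-≤ (begin
  toℚᵘ (+ m / 1)      ≃⟨ ℚ.toℚᵘ-fromℚᵘ (mkℚᵘ (+ m) 0) ⟩
  -- `mkℚᵘ` stores the denominator minus one; cross-multiplying without reduction to lowest terms
  -- leaves `m * suc d ≤ n * 1` over the integers.
  mkℚᵘ (+ m) 0        ≤⟨ *≤* (subst₂ ℤ._≤_ (ℤ.pos-* m (suc d)) (sym (ℤ.*-identityʳ (+ n)))
                               (+≤+ m*d≤n)) ⟩
  mkℚᵘ (+ n) d        ≃⟨ ℚ.toℚᵘ-fromℚᵘ (mkℚᵘ (+ n) d) ⟨
  toℚᵘ (+ n / suc d)  ∎)
  where open ℚᵘ.≤-Reasoning

fromℚ-mono-≤ : ∀ {p q} → p ℚ.≤ q → fromℚ p ≤ᴿ fromℚ q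
fromℚ-mono-≤ p≤q q<r = ℚ.≤-<-trans p≤q q<r

theorem3 : (G : OrientedGraph) →
    (fromℕ (ωᵣₒ G) ≤ᴿ χ*ₒ G) × (χ*ₒ G ≤ᴿ fromℕ (χₒ G))
theorem3 G =
    infimum-greatest 0 (foldRatio G) lb (fromℕ (ωᵣₒ G))
      (λ b → fromℚ-mono-≤
        (m*d≤n⇒m/1≤n/d (ωᵣₒ G) (χᵇₒ G (suc b)) b (ωᵣₒ*b≤χᵇₒ G b)))
  -- Index `0` is fold number 1, where the ratio is `χₒ G` over 1 by definition.
  , infimum-lowerBound 0 (foldRatio G) lb 0
  where lb = _ , 0≤foldRatio G
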